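{- Let $\mathcal{T}$ be an $\mathcal{ALC}$-TBox, $\Sigma\subseteq\mathsf{sig}(\mathcal{T})$, and $m\geq 0$. Then $\mathcal{T}_{\Sigma,m}$ is not a uniform $\Sigma$-interpolant of $\mathcal{T}$ if and only if the following condition $(\ast_m)$ holds: there exist two $\Sigma$-tree interpretations $\mathcal{I}_1$ and $\mathcal{I}_2$ of finite outdegree such that (1) $\mathcal{I}_1^{\leq m}=\mathcal{I}_2^{\leq m}$; (2) $(\mathcal{I}_1,\rho^{\mathcal{I}_1})\models\exists^\sim_{\overline{\Sigma}}.\mathcal{T}$; (3) $(\mathcal{I}_2,\rho^{\mathcal{I}_2})\not\models\exists^\sim_{\overline{\Sigma}}.\mathcal{T}$; (4) for all successors $d$ of $\rho^{\mathcal{I}_2}$: $(\mathcal{I}_2,d)\models\exists^\sim_{\overline{\Sigma}}.\mathcal{T}$.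
   Context: $\mathcal{ALC}$-concepts are built from disjoint countably infinite sets $N_C$ (concept names) and $N_R$ (role names) by $C::=\top\mid A\mid\neg C\mid C\sqcap D\mid\exists r.C$ with standard semantics in interpretations $\mathcal{I}=(\Delta^{\mathcal{I}},\cdot^{\mathcal{I}})$. A TBox is a finite set of inclusions $C\sqsubseteq D$; models and $\mathcal{T}\models C\sqsubseteq D$ are as usual; $\mathsf{sig}$ gives the set of concept and role names occurring; $\Sigma$-concepts/inclusions/TBoxes are those using only names from $\Sigma$. A TBox $\mathcal{T}'$ is a uniform $\Sigma$-interpolant of $\mathcal{T}$ if $\mathsf{sig}(\mathcal{T}')\subseteq\Sigma\subseteq\mathsf{sig}(\mathcal{T})$ and $\mathcal{T}$, $\mathcal{T}'$ entail the same $\Sigma$-inclusions. The role depth $\mathsf{rd}(C)$ is the nesting depth of existential restrictions in $C$. For finite $\Sigma$ and $m\ge0$, $\mathcal{C}^m_f(\Sigma)$ is a fixed finite set of $\Sigma$-concepts of role depth $\le m$ such that every $\Sigma$-concept of role depth $\le m$ is equivalent to some member of it, and $\mathcal{T}_{\Sigma,m}=\{C\sqsubseteq D\mid \mathcal{T}\models C\sqsubseteq D,\ C,D\in\mathcal{C}^m_f(\Sigma)\}$. A $\Sigma$-bisimulation between pointed interpretations $(\mathcal{I}_1,d_1)$, $(\mathcal{I}_2,d_2)$ is a relation $S$ containing $(d_1,d_2)$ such that related elements agree on concept names in $\Sigma$, and for each role name $r\in\Sigma$ every $r$-successor of one related element is $S$-related to some $r$-successor of the other (in both directions). $(\mathcal{I},d)\models\exists^\sim_{\overline{\Sigma}}.\mathcal{T}$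 means $(\mathcal{I},d)$ is $\Sigma$-bisimilar to $(\mathcal{J},d')$ for some model $\mathcal{J}$ of $\mathcal{T}$. An interpretation has finite outdegree if every element has only finitely many successors via $\bigcup_{r\in N_R}r^{\mathcal{I}}$. $\mathcal{I}$ is a tree interpretation if the undirected graph $(\Delta^{\mathcal{I}},\bigcup_{r}r^{\mathcal{I}})$ is a (possibly infinite) tree and $r^{\mathcal{I}}\cap s^{\mathcal{I}}=\emptyset$ for distinct $r,s$; $\rho^{\mathcal{I}}$ is its root; a $\Sigma$-tree interpretation is a tree interpretation interpreting only names from $\Sigma$. $\mathcal{I}^{\le m}$ is the restriction of $\mathcal{I}$ to the elements reachable from $\rho^{\mathcal{I}}$ in at most $m$ steps in $(\Delta^{\mathcal{I}},\bigcup_r r^{\mathcal{I}})$. -}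

module Defs where

open import Data.Nat using (ℕ; zero; suc; _≤_; _⊔_)
open import Data.List using (List; []; _∷_; _++_)
open import Data.List.Membership.Propositional using (_∈_)
open import Data.Product using (Σ; Σ-syntax; ∃; ∃-syntax; _×_; _,_; proj₁)
open import Data.Sum using (_⊎_)
open import Data.Unit using (⊤)
open import Data.Empty using (⊥)
open import Relation.Nullary using (¬_)
open import Relation.Binary.PropositionalEquality using (_≡_)
open import Function.Bundles using (_⇔_)

-- Syntax.  Concept names N_C and role names N_R are two disjoint
-- countably infinite sets; both are represented by ℕ, kept apart by
-- the constructors that use them.

CName : Set
CName = ℕ

RName : Set
RName = ℕ

data Concept : Set where
  top  : Concept
  atom : CName → Concept
  neg  : Concept → Concept
  _⊓_  : Concept → Concept → Concept
  ex   : RName → Concept → Concept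

Inclusion : Set
Inclusion = Concept × Concept

TBox : Set
TBox = List Inclusion

rd : Concept → ℕ
rd top       = 0
rd (atom A)  = 0
rd (neg C)   = rd C
rd (C ⊓ D)   = rd C ⊔ rd D
rd (ex r C)  = suc (rd C)

record Signature : Set where
  constructor sigma
  field
    cnames : List CName
    rnames : List RName
open Signature public

sigC : Concept → List CName
sigC top      = []
sigC (atom A) = A ∷ []
sigC (neg C)  = sigC C
sigC (C ⊓ D)  = sigC C ++ sigC D
sigC (ex r C) = sigC C

sigR : Concept → List RName
sigR top      = []
sigR (atom A) = []
sigR (neg C)  = sigR C
sigR (C ⊓ D)  = sigR C ++ sigR D
sigR (ex r C) = r ∷ sigR C

sigT : TBox → Signature
sigT []             = sigma [] []
sigT ((C , D) ∷ T)  =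
  sigma (sigC C ++ sigC D ++ cnames (sigT T))
        (sigR C ++ sigR D ++ rnames (sigT T))

_⊆Sig_ : Signature → Signature → Set
S ⊆Sig S' = (∀ {A} → A ∈ cnames S → A ∈ cnames S')
          × (∀ {r} → r ∈ rnames S → r ∈ rnames S')

IsSigConcept : Signature → Concept → Set
IsSigConcept S C = (∀ {A} → A ∈ sigC C → A ∈ cnames S)
                 × (∀ {r} → r ∈ sigR C → r ∈ rnames S)

IsSigInclusion : Signature → Inclusion → Set
IsSigInclusion S (C , D) = IsSigConcept S C × IsSigConcept S D

record Interp : Set₁ where
  field
    Δ    : Set
    conc : CName → Δ → Set
    role : RName → Δ → Δ → Set
open Interp public

⟦_⟧ : Concept → (I : Interp) → Δ I → Set
⟦ top ⟧    I d = ⊤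
⟦ atom A ⟧ I d = conc I A d
⟦ neg C ⟧  I d = ¬ (⟦ C ⟧ I d)
⟦ C ⊓ D ⟧  I d = ⟦ C ⟧ I d × ⟦ D ⟧ I d
⟦ ex r C ⟧ I d = Σ[ e ∈ Δ I ] (role I r d e × ⟦ C ⟧ I e)

SatIncl : Interp → Inclusion → Set
SatIncl I (C , D) = ∀ d → ⟦ C ⟧ I d → ⟦ D ⟧ I d

IsModel : Interp → TBox → Set
IsModel I T = ∀ {α} → α ∈ T → SatIncl I α

_⊨_ : TBox → Inclusion → Set₁
T ⊨ α = ∀ (I : Interp) → IsModel I T → SatIncl I α

-- Sets of inclusions given by a membership predicate (used for the
-- TBox T_{Σ,m}, which is finite but defined via entailment).
InclSet : Set₂
InclSet = Inclusion → Set₁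

IsModelS : Interp → InclSet → Set₁
IsModelS I T = ∀ α → T α → SatIncl I α

_⊨S_ : InclSet → Inclusion → Set₁
T ⊨S α = ∀ (I : Interp) → IsModelS I T → SatIncl I α

IsUniformInterpolant : InclSet → Signature → TBox → Set₁
IsUniformInterpolant T' S T =
    (∀ α → T' α → IsSigInclusion S α)
  × (S ⊆Sig sigT T)
  × (∀ α → IsSigInclusion S α → (T ⊨ α → T' ⊨S α) × (T' ⊨S α → T ⊨ α))

_≡C_ : Concept → Concept → Set₁
C ≡C D = ∀ (I : Interp) d → (⟦ C ⟧ I d → ⟦ D ⟧ I d) × (⟦ D ⟧ I d → ⟦ C ⟧ I d)

-- Cs is an admissible choice of C^m_f(Σ): a finite set of Σ-concepts
-- of role depth ≤ m such that every Σ-concept of role depth ≤ m is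
-- equivalent to a member.
IsCmf : Signature → ℕ → List Concept → Set₁
IsCmf S m Cs =
    (∀ {C} → C ∈ Cs → IsSigConcept S C × rd C ≤ m)
  × (∀ C → IsSigConcept S C → rd C ≤ m → Σ[ D ∈ Concept ] (D ∈ Cs × C ≡C D))

TSigm : TBox → List Concept → InclSet
TSigm T Cs (C , D) = (C ∈ Cs × D ∈ Cs) × (T ⊨ (C , D))

IsSigBisim : Signature → (I J : Interp) → (Δ I → Δ J → Set) → Set
IsSigBisim S I J Z =
  ∀ {x y} → Z x y →
      (∀ {A} → A ∈ cnames S → (conc I A x → conc J A y) × (conc J A y → conc I A x))
    × (∀ {r} → r ∈ rnames S → ∀ {x'} → role I r x x' →
          Σ[ y' ∈ Δ J ] (role J r y y' × Z x' y'))
    × (∀ {r} → r ∈ rnames S → ∀ {y'} → role J r y y' →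
          Σ[ x' ∈ Δ I ] (role I r x x' × Z x' y'))

SigBisimilar : Signature → (I : Interp) → Δ I → (J : Interp) → Δ J → Set₁
SigBisimilar S I d J e =
  Σ[ Z ∈ (Δ I → Δ J → Set) ] (Z d e × IsSigBisim S I J Z)

SatExSim : Signature → TBox → (I : Interp) → Δ I → Set₁
SatExSim S T I d =
  Σ[ J ∈ Interp ] (IsModel J T × Σ[ e ∈ Δ J ] SigBisimilar S I d J e)

data Path (I : Interp) : ℕ → Δ I → Δ I → Set where
  here : ∀ {d} → Path I 0 d d
  step : ∀ {k r d e f} → role I r d e → Path I k e f → Path I (suc k) d f

Within : (I : Interp) → ℕ → Δ I → Δ I → Set
Within I n d e = Σ[ k ∈ ℕ ] (k ≤ n × Path I k d e)

record IsTree (I : Interp) (ρ : Δ I) : Set where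
  field
    reachable : ∀ d → Σ[ k ∈ ℕ ] Path I k ρ d
    rootNoPred : ∀ {r d} → ¬ role I r d ρ
    uniquePred : ∀ {r s d d' e} → role I r d e → role I s d' e → (r ≡ s × d ≡ d')

OnlySig : Signature → Interp → Set
OnlySig S I = (∀ A d → conc I A d → A ∈ cnames S)
            × (∀ r d e → role I r d e → r ∈ rnames S)

IsSigTree : Signature → (I : Interp) → Δ I → Set
IsSigTree S I ρ = IsTree I ρ × OnlySig S I

FiniteOutdegree : Interp → Set
FiniteOutdegree I =
  ∀ d → Σ[ l ∈ List (Δ I) ] (∀ {r e} → role I r d e → e ∈ l)

-- I₁^{≤m} = I₂^{≤m} (for tree interpretations with roots ρ₁, ρ₂):
-- the restrictions to the elements reachable from the roots in ≤ m
-- steps coincide, i.e. are identical up to a renaming of elements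
-- that maps root to root.
record SameUpTo (m : ℕ) (I₁ : Interp) (ρ₁ : Δ I₁) (I₂ : Interp) (ρ₂ : Δ I₂) : Set where
  field
    to      : Δ I₁ → Δ I₂
    from    : Δ I₂ → Δ I₁
    to-in   : ∀ {d} → Within I₁ m ρ₁ d → Within I₂ m ρ₂ (to d)
    from-in : ∀ {d} → Within I₂ m ρ₂ d → Within I₁ m ρ₁ (from d)
    from-to : ∀ {d} → Within I₁ m ρ₁ d → from (to d) ≡ d
    to-from : ∀ {d} → Within I₂ m ρ₂ d → to (from d) ≡ d
    root    : to ρ₁ ≡ ρ₂
    conc-eq : ∀ {A d} → Within I₁ m ρ₁ d →
                (conc I₁ A d → conc I₂ A (to d)) × (conc I₂ A (to d) → conc I₁ A d)
    role-eq : ∀ {r d e} → Within I₁ m ρ₁ d → Within I₁ m ρ₁ e →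
                (role I₁ r d e → role I₂ r (to d) (to e))
              × (role I₂ r (to d) (to e) → role I₁ r d e)

StarCond : Signature → TBox → ℕ → Set₁
StarCond S T m =
  Σ[ I₁ ∈ Interp ] Σ[ ρ₁ ∈ Δ I₁ ] Σ[ I₂ ∈ Interp ] Σ[ ρ₂ ∈ Δ I₂ ]
    ( IsSigTree S I₁ ρ₁ × FiniteOutdegree I₁
    × IsSigTree S I₂ ρ₂ × FiniteOutdegree I₂
    × SameUpTo m I₁ ρ₁ I₂ ρ₂
    × SatExSim S T I₁ ρ₁
    × ¬ SatExSim S T I₂ ρ₂
    × (∀ {r d} → role I₂ r ρ₂ d → SatExSim S T I₂ d) )

{-# OPTIONS --safe #-}
module Submission where

open import Defs
open import Data.Nat using (ℕ; zero; suc; pred; _≤_; _<_; _⊔_; _+_; _≤?_; z≤n; s≤s)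
open import Data.Nat.Properties
  using (≤-refl; ≤-trans; ≤-reflexive; n≤1+n; ≤-pred; m≤m⊔n; m≤n⊔m; ⊔-lub; +-suc;
         +-identityʳ; m≤n+m; <⇒≤; <-irrefl; ≰⇒>)
open import Data.Bool.Properties using (T-irrelevant)
open import Data.Fin using (Fin)
open import Data.List
  using (List; []; _∷_; _++_; map; concatMap; filter; cartesianProduct; allFin; length; lookup; foldr)
open import Data.List.Membership.Propositional using (_∈_; lose)
open import Data.List.Membership.Propositional.Properties
  using (∈-map⁺; ∈-map⁻; ∈-++⁺ˡ; ∈-++⁺ʳ; ∈-++⁻; ∈-concatMap⁺; ∈-filter⁺;
         ∈-filter⁻; ∈-cartesianProduct⁺; ∈-cartesianProduct⁻; ∈-allFin; ∈-lookup)
open import Data.List.Relation.Unary.Any using (here; there; index)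
open import Data.List.Relation.Unary.Any.Properties using (lookup-index)
open import Data.Product using (Σ; Σ-syntax; _×_; _,_; proj₁; proj₂; swap)
open import Data.Sum using (_⊎_; inj₁; inj₂; [_,_]′)
open import Data.Unit using (⊤; tt)
open import Data.Empty using (⊥; ⊥-elim)
open import Function using (_∘_; id)
open import Relation.Nullary using (¬_; Dec; yes; no; contradiction)
open import Relation.Nullary.Decidable using (True; toWitness; fromWitness; decidable-stable)
open import Relation.Binary.PropositionalEquality
  using (_≡_; refl; sym; trans; cong; cong₂; subst)
open import Axiom.ExcludedMiddle using (ExcludedMiddle)

-- Failure of the interpolant ⇒ (∗ₘ).  Take the least n for which some Σ-concept E
-- of depth n+1 is satisfiable with T_{Σ,m} but not with T; then n ≥ m.  In a finite
-- model I of T_{Σ,m} with E at d₀, characteristic concepts of depth n replace every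
-- successor of d₀ by an n-bisimilar point of a finite model of T, so E survives at
-- the new root.  Depth m characteristic concepts give a model of T that is
-- m-bisimilar to this root, and a joint unravelling makes the first m levels equal.
--
-- (∗ₘ) ⇒ failure.  I₂ satisfies T_{Σ,m}, at the root because I₁ does.  Were T_{Σ,m}
-- an interpolant, every Σ-concept true at the root would be satisfiable with T.  As
-- I₂ is finitely branching, a filtration-style saturation then yields a model of T
-- bisimilar to the root, contradicting (3).

-- Satisfiability and finite conjunctions.

infix 3 _⟷_
_⟷_ : Set → Set → Set
A ⟷ B = (A → B) × (B → A)

_⟷∘_ : ∀ {A B C} → B ⟷ C → A ⟷ B → A ⟷ C
(f , g) ⟷∘ (f′ , g′) = f ∘ f′ , g′ ∘ g

Sat : TBox → Concept → Set₁
Sat T C = Σ[ I ∈ Interp ] (IsModel I T × Σ[ d ∈ Δ I ] ⟦ C ⟧ I d)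

unsat⇒⊨ : ∀ {T C D} → ¬ Sat T C → T ⊨ (C , D)
unsat⇒⊨ unsat I mod d c = ⊥-elim (unsat (I , mod , d , c))

⋀ : List Concept → Concept
⋀ = foldr _⊓_ top

⋀-intro : ∀ {I d} Cs → (∀ {C} → C ∈ Cs → ⟦ C ⟧ I d) → ⟦ ⋀ Cs ⟧ I d
⋀-intro []       h = tt
⋀-intro (C ∷ Cs) h = h (here refl) , ⋀-intro Cs (h ∘ there)

⋀-elim : ∀ {I d C} Cs → ⟦ ⋀ Cs ⟧ I d → C ∈ Cs → ⟦ C ⟧ I d
⋀-elim (C ∷ Cs) (c , cs) (here refl) = c
⋀-elim (C ∷ Cs) (c , cs) (there i)   = ⋀-elim Cs cs i

-- Bounded bisimilarity and Σ-concepts of bounded depth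

module _ (S : Signature) where

  record Small (k : ℕ) (C : Concept) : Set where
    constructor small
    field
      sig   : IsSigConcept S C
      depth : rd C ≤ k
  open Small public

  small-top : ∀ {k} → Small k top
  small-top = small ((λ ()) , λ ()) z≤n

  small-neg : ∀ {k C} → Small k C → Small k (neg C)
  small-neg (small s u) = small s u

  small-neg⁻ : ∀ {k C} → Small k (neg C) → Small k C
  small-neg⁻ (small s u) = small s u

  small-⊓ : ∀ {k C D} → Small k C → Small k D → Small k (C ⊓ D)
  small-⊓ {C = C} (small (a , b) u) (small (c , d) v) =
    small ([ a , c ]′ ∘ ∈-++⁻ (sigC C) , [ b , d ]′ ∘ ∈-++⁻ (sigR C)) (⊔-lub u v)

  small-⊓⁻ : ∀ {k C D} → Small k (C ⊓ D) → Small k C × Small k D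
  small-⊓⁻ {C = C} {D} (small (a , b) u) =
    small (a ∘ ∈-++⁺ˡ , b ∘ ∈-++⁺ˡ) (≤-trans (m≤m⊔n (rd C) (rd D)) u) ,
    small (a ∘ ∈-++⁺ʳ (sigC C) , b ∘ ∈-++⁺ʳ (sigR C)) (≤-trans (m≤n⊔m (rd C) (rd D)) u)

  small-ex : ∀ {k r C} → r ∈ rnames S → Small k C → Small (suc k) (ex r C)
  small-ex r∈ (small (a , b) u) = small (a , λ { (here refl) → r∈ ; (there i) → b i }) (s≤s u)

  small-ex⁻ : ∀ {k r C} → Small (suc k) (ex r C) → r ∈ rnames S × Small k C
  small-ex⁻ (small (a , b) u) = b (here refl) , small (a , b ∘ there) (≤-pred u)

  small-≤ : ∀ {j k C} → j ≤ k → Small j C → Small k C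
  small-≤ p (small s u) = small s (≤-trans u p)

  small-⋀ : ∀ {k} Cs → (∀ {C} → C ∈ Cs → Small k C) → Small k (⋀ Cs)
  small-⋀ []       h = small-top
  small-⋀ (C ∷ Cs) h = small-⊓ (h (here refl)) (small-⋀ Cs (h ∘ there))

  module _ (I J : Interp) where

    SameAtoms : Δ I → Δ J → Set
    SameAtoms x y = ∀ {A} → A ∈ cnames S → conc I A x ⟷ conc J A y

    Forth : (Δ I → Δ J → Set) → Δ I → Δ J → Set
    Forth Z x y = ∀ {r} → r ∈ rnames S → ∀ {x′} → role I r x x′ →
      Σ[ y′ ∈ Δ J ] (role J r y y′ × Z x′ y′)

    Back : (Δ I → Δ J → Set) → Δ I → Δ J → Set
    Back Z x y = ∀ {r} → r ∈ rnames S → ∀ {y′} → role J r y y′ →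
      Σ[ x′ ∈ Δ I ] (role I r x x′ × Z x′ y′)

    -- The k-round Σ-bisimulation game. Recursion on the number of rounds keeps it in `Set`, whereas
    -- `SigBisimilar` quantifies over relations; edges of an interpretation can therefore mention
    -- it.
    Bis : ℕ → Δ I → Δ J → Set
    Bis zero    x y = SameAtoms x y
    Bis (suc k) x y = SameAtoms x y × Forth (Bis k) x y × Back (Bis k) x y

  module _ {I J : Interp} where

    bis-atoms : ∀ k {x y} → Bis I J k x y → SameAtoms I J x y
    bis-atoms zero    b = b
    bis-atoms (suc k) b = proj₁ b

    bis-≤ : ∀ {j k x y} → j ≤ k → Bis I J k x y → Bis I J j x y
    bis-≤ {k = k} z≤n b = bis-atoms k b
    bis-≤ (s≤s p) (a , f , g) =
      a , (λ r∈ e → let (y , e′ , b) = f r∈ e in y , e′ , bis-≤ p b)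
        , (λ r∈ e → let (x , e′ , b) = g r∈ e in x , e′ , bis-≤ p b)

    bis-sym : ∀ k {x y} → Bis I J k x y → Bis J I k y x
    bis-sym zero    a = λ A∈ → swap (a A∈)
    bis-sym (suc k) (a , f , g) =
      (λ A∈ → swap (a A∈))
        , (λ r∈ e → let (x , e′ , b) = g r∈ e in x , e′ , bis-sym k b)
        , (λ r∈ e → let (y , e′ , b) = f r∈ e in y , e′ , bis-sym k b)

    -- Each existential restriction spends one round, and `Small` ensures both that a round is left
    -- and that the role lies in Σ.
    bis-concept : ∀ k C {x y} → Small k C → Bis I J k x y → ⟦ C ⟧ I x ⟷ ⟦ C ⟧ J y
    bis-concept k top      s b = id , id
    bis-concept k (atom A) s b = bis-atoms k b (proj₁ (sig s) (here refl))
    bis-concept k (neg C)  s b =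
      let (f , g) = bis-concept k C (small-neg⁻ s) b in (λ n c → n (g c)) , (λ n c → n (f c))
    bis-concept k (C ⊓ D)  s b =
      let (sC , sD) = small-⊓⁻ s
          (f , g)   = bis-concept k C sC b
          (f′ , g′) = bis-concept k D sD b
      in (λ (c , d) → f c , f′ d) , (λ (c , d) → g c , g′ d)
    bis-concept zero    (ex r C) (small _ ()) b
    bis-concept (suc k) (ex r C) s (a , f , g) =
      let (r∈ , sC) = small-ex⁻ s in
      (λ (_ , e , c) → let (y , e′ , b) = f r∈ e in y , e′ , proj₁ (bis-concept k C sC b) c) ,
      (λ (_ , e , c) → let (x , e′ , b) = g r∈ e in x , e′ , proj₂ (bis-concept k C sC b) c)

    bisim⇒bis : ∀ {Z} → IsSigBisim S I J Z → ∀ k {x y} → Z x y → Bis I J k x y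
    bisim⇒bis bs zero    z = proj₁ (bs z)
    bisim⇒bis bs (suc k) z =
      let (a , f , g) = bs z in
      a , (λ r∈ e → let (y , e′ , z′) = f r∈ e in y , e′ , bisim⇒bis bs k z′)
        , (λ r∈ e → let (x , e′ , z′) = g r∈ e in x , e′ , bisim⇒bis bs k z′)

    bisimilar⇒bis : ∀ {x y} → SigBisimilar S I x J y → ∀ k → Bis I J k x y
    bisimilar⇒bis (_ , z , bs) k = bisim⇒bis bs k z

    bisimilar-concept : ∀ C {x y} → IsSigConcept S C → SigBisimilar S I x J y →
      ⟦ C ⟧ I x ⟷ ⟦ C ⟧ J y
    bisimilar-concept C s b = bis-concept (rd C) C (small s ≤-refl) (bisimilar⇒bis b (rd C))

    bisimilar-sym : ∀ {x y} → SigBisimilar S I x J y → SigBisimilar S J y I x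
    bisimilar-sym (Z , z , bs) =
      (λ y x → Z x y) , z , λ z′ → let (a , f , g) = bs z′ in (λ A∈ → swap (a A∈)) , g , f

  bis-trans : ∀ {I J K} k {x y z} → Bis I J k x y → Bis J K k y z → Bis I K k x z
  bis-trans zero    a a′ = λ A∈ → a′ A∈ ⟷∘ a A∈
  bis-trans (suc k) (a , f , g) (a′ , f′ , g′) =
    (λ A∈ → a′ A∈ ⟷∘ a A∈) ,
    (λ r∈ e → let (y , e′ , b)  = f r∈ e
                  (z , e″ , b′) = f′ r∈ e′
              in z , e″ , bis-trans k b b′) ,
    (λ r∈ e → let (y , e′ , b)  = g′ r∈ e
                  (x , e″ , b′) = g r∈ e′
              in x , e″ , bis-trans k b′ b)

  bisimilar-refl : ∀ {I x} → SigBisimilar S I x I x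
  bisimilar-refl = _≡_ , refl , λ { refl →
    (λ _ → id , id) , (λ _ e → _ , e , refl) , λ _ e → _ , e , refl }

  bisimilar-trans : ∀ {I J K x y z} →
    SigBisimilar S I x J y → SigBisimilar S J y K z → SigBisimilar S I x K z
  bisimilar-trans {J = J} (Z , z , bs) (Z′ , z′ , bs′) =
    (λ x w → Σ[ y ∈ Δ J ] (Z x y × Z′ y w)) , (_ , z , z′) ,
    λ (y , u , v) →
      let (a , f , g) = bs u ; (a′ , f′ , g′) = bs′ v in
      (λ A∈ → a′ A∈ ⟷∘ a A∈) ,
      (λ r∈ e → let (y , e′ , b)  = f r∈ e
                    (w , e″ , b′) = f′ r∈ e′
                in w , e″ , y , b , b′) ,
      (λ r∈ e → let (y , e′ , b)  = g′ r∈ e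
                    (x , e″ , b′) = g r∈ e′
                in x , e″ , y , b′ , b)

  satExSim-bisimilar : ∀ {T I J x y} → SigBisimilar S I x J y → SatExSim S T J y → SatExSim S T I x
  satExSim-bisimilar b (K , mod , z , b′) = K , mod , z , bisimilar-trans b b′

  satExSim-step : ∀ {T I r x x′} → r ∈ rnames S → role I r x x′ →
    SatExSim S T I x → SatExSim S T I x′
  satExSim-step r∈ e (K , mod , z , Z , zz , bs) =
    let (z′ , _ , zz′) = proj₁ (proj₂ (bs zz)) r∈ e in K , mod , z′ , Z , zz′ , bs

  -- `C` is carried along the bisimulation into the model of `T`, where the entailment applies, and
  -- `D` is carried back.
  satExSim-entailed : ∀ {T I x C D} → IsSigConcept S C → IsSigConcept S D → T ⊨ (C , D) →
    SatExSim S T I x → ⟦ C ⟧ I x → ⟦ D ⟧ I x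
  satExSim-entailed {C = C} {D} sC sD ent (K , mod , z , b) c =
    proj₂ (bisimilar-concept D sD b) (ent K mod z (proj₁ (bisimilar-concept C sC b) c))
Pointed : Set₁
Pointed = Σ Interp Δ

_⊩_ : Pointed → Concept → Set
(I , d) ⊩ C = ⟦ C ⟧ I d

ModelPoint : TBox → Pointed → Set
ModelPoint T (I , _) = IsModel I T

-- Filtration through finitely many types

parts : Concept → List Concept
parts top      = []
parts (atom A) = []
parts (neg C)  = C ∷ []
parts (C ⊓ D)  = C ∷ D ∷ []
parts (ex r C) = C ∷ []

Closed : List Concept → Set
Closed cl = ∀ {C D} → C ∈ cl → D ∈ parts C → D ∈ cl

closed-∷ : ∀ C {cl} → (∀ {D} → D ∈ parts C → D ∈ cl) → Closed cl → Closed (C ∷ cl)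
closed-∷ C p h (here refl) j = there (p j)
closed-∷ C p h (there i)   j = there (h i j)

closed-++ : ∀ cl {cl′} → Closed cl → Closed cl′ → Closed (cl ++ cl′)
closed-++ cl h h′ i j with ∈-++⁻ cl i
... | inj₁ k = ∈-++⁺ˡ (h k j)
... | inj₂ k = ∈-++⁺ʳ cl (h′ k j)

sub : Concept → List Concept
sub top      = top ∷ []
sub (atom A) = atom A ∷ []
sub (neg C)  = neg C ∷ sub C
sub (C ⊓ D)  = (C ⊓ D) ∷ sub C ++ sub D
sub (ex r C) = ex r C ∷ sub C

self∈sub : ∀ C → C ∈ sub C
self∈sub top      = here refl
self∈sub (atom A) = here refl
self∈sub (neg C)  = here refl
self∈sub (C ⊓ D)  = here refl
self∈sub (ex r C) = here refl

sub-closed : ∀ C → Closed (sub C)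
sub-closed top      = closed-∷ top (λ ()) λ ()
sub-closed (atom A) = closed-∷ (atom A) (λ ()) λ ()
sub-closed (neg C)  = closed-∷ (neg C) (λ { (here refl) → self∈sub C }) (sub-closed C)
sub-closed (C ⊓ D)  =
  closed-∷ (C ⊓ D)
    (λ { (here refl) → ∈-++⁺ˡ (self∈sub C) ; (there (here refl)) → ∈-++⁺ʳ (sub C) (self∈sub D) })
    (closed-++ (sub C) (sub-closed C) (sub-closed D))
sub-closed (ex r C) = closed-∷ (ex r C) (λ { (here refl) → self∈sub C }) (sub-closed C)

-- `Es` holds the concepts outside `T` whose truth the filtration must also preserve.
closure : List Concept → TBox → List Concept
closure Es T = concatMap sub (Es ++ map proj₁ T ++ map proj₂ T)

closure-closed : ∀ Es T → Closed (closure Es T)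
closure-closed Es T = go (Es ++ map proj₁ T ++ map proj₂ T)
  where
  go : ∀ Cs → Closed (concatMap sub Cs)
  go []       ()
  go (C ∷ Cs) = closed-++ (sub C) (sub-closed C) (go Cs)

∈-concatMap-sub : ∀ {C Cs} → C ∈ Cs → C ∈ concatMap sub Cs
∈-concatMap-sub {C} i = ∈-concatMap⁺ sub (lose i (self∈sub C))

extra∈closure : ∀ {Es T C} → C ∈ Es → C ∈ closure Es T
extra∈closure i = ∈-concatMap-sub (∈-++⁺ˡ i)

Covers : List Concept → TBox → Set
Covers cl T = ∀ {C D} → (C , D) ∈ T → C ∈ cl × D ∈ cl

closure-covers : ∀ Es T → Covers (closure Es T) T
closure-covers Es T i =
  ∈-concatMap-sub (∈-++⁺ʳ Es (∈-++⁺ˡ (∈-map⁺ proj₁ i))) ,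
  ∈-concatMap-sub (∈-++⁺ʳ Es (∈-++⁺ʳ (map proj₁ T) (∈-map⁺ proj₂ i)))

Agree : List Concept → Pointed → Pointed → Set
Agree cl p q = ∀ {C} → C ∈ cl → p ⊩ C ⟷ q ⊩ C

-- The accessibility relation of the largest filtration.
Compat : List Concept → RName → Pointed → Pointed → Set
Compat cl r p q = ∀ {C} → ex r C ∈ cl → q ⊩ C → p ⊩ ex r C

-- If `ex r C` is in `cl`, closure under parts puts `C` there too, so the truth of `C` moves from
-- `q` to `e`, back along the edge, and on to `p`.
step-compat : ∀ {cl r I d e p q} → Closed cl → role I r d e →
  Agree cl (I , d) p → Agree cl (I , e) q → Compat cl r p q
step-compat clo re a b i c = proj₁ (a i) (_ , re , proj₂ (b (clo i (here refl))) c)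

module _ {cl} (clo : Closed cl) (J : Interp) (type : Δ J → Pointed)
  (atoms : ∀ {A} → atom A ∈ cl → ∀ x → conc J A x ⟷ type x ⊩ atom A)
  (compat : ∀ {r x y} → role J r x y → Compat cl r (type x) (type y))
  (witness : ∀ {r C} → ex r C ∈ cl → ∀ x → type x ⊩ ex r C →
    Σ[ y ∈ Δ J ] (role J r x y × type y ⊩ C))
  where

  -- The truth lemma of filtration, by induction on the concept: `compat` gives one direction for
  -- existential restrictions and `witness` the other. The module parameters let it serve both
  -- `typeModel` and `saturated`.
  truth : ∀ x → Agree cl (J , x) (type x)
  truth x {C} = go C x
    where
    go : ∀ C x → C ∈ cl → (J , x) ⊩ C ⟷ type x ⊩ C
    go top      x i = id , id
    go (atom A) x i = atoms i x
    go (neg C)  x i =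
      let (f , g) = go C x (clo i (here refl)) in (λ n c → n (g c)) , (λ n c → n (f c))
    go (C ⊓ D)  x i =
      let (f , g)   = go C x (clo i (here refl))
          (f′ , g′) = go D x (clo i (there (here refl)))
      in (λ (c , d) → f c , f′ d) , (λ (c , d) → g c , g′ d)
    go (ex r C) x i =
      (λ (y , ry , c) → compat ry i (proj₁ (go C y (clo i (here refl))) c)) ,
      (λ h → let (y , ry , c) = witness i x h
             in y , ry , proj₂ (go C y (clo i (here refl))) c)

  truth-model : ∀ {T} → Covers cl T → (∀ x → ModelPoint T (type x)) → IsModel J T
  truth-model cov mod {C , D} i x c =
    let (iC , iD) = cov i in
    proj₂ (truth x iD) (mod x i (proj₂ (type x)) (proj₁ (truth x iC) c))

fin-outdegree : ∀ I (l : List (Δ I)) → (∀ x → x ∈ l) → FiniteOutdegree I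
fin-outdegree I l all d = l , λ _ → all _

record FiniteCopy (T : TBox) (S : Signature) (I : Interp) (k : ℕ) (d : Δ I) : Set₁ where
  field
    {model}  : Interp
    isModel  : IsModel model T
    finite   : FiniteOutdegree model
    {centre} : Δ model
    bis      : Bis S I model k d centre

module Classical (lem : ∀ {ℓ} → ExcludedMiddle ℓ) where

  dne : ∀ {ℓ} {P : Set ℓ} → ¬ ¬ P → P
  dne = decidable-stable lem

  -- Characteristic concepts of bounded depth.

  module Characteristic (S : Signature) (I : Interp) (fin : FiniteOutdegree I) where

    successors : RName → Δ I → List (Δ I)
    successors r d = filter (λ e → lem {P = role I r d e}) (proj₁ (fin d))

    ∈-successors⁺ : ∀ {r d e} → role I r d e → e ∈ successors r d
    ∈-successors⁺ {d = d} p = ∈-filter⁺ (λ _ → lem) (proj₂ (fin d) p) p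

    ∈-successors⁻ : ∀ {r d e} → e ∈ successors r d → role I r d e
    ∈-successors⁻ {d = d} i = proj₂ (∈-filter⁻ (λ _ → lem) {xs = proj₁ (fin d)} i)

    literal : Δ I → CName → Concept
    literal d A with lem {P = conc I A d}
    ... | yes _ = atom A
    ... | no  _ = neg (atom A)

    literal-holds : ∀ d A → ⟦ literal d A ⟧ I d
    literal-holds d A with lem {P = conc I A d}
    ... | yes p = p
    ... | no ¬p = ¬p

    literal-decides : ∀ d A {J y} → ⟦ literal d A ⟧ J y → conc I A d ⟷ conc J A y
    literal-decides d A h with lem {P = conc I A d}
    ... | yes p = (λ _ → h) , (λ _ → p)
    ... | no ¬p = (λ p → contradiction p ¬p) , (λ q → contradiction q h)

    literal-small : ∀ {d A} → A ∈ cnames S → Small S 0 (literal d A)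
    literal-small {d} {A} A∈ with lem {P = conc I A d}
    ... | yes _ = small ((λ { (here refl) → A∈ }) , λ ()) z≤n
    ... | no  _ = small ((λ { (here refl) → A∈ }) , λ ()) z≤n

    literals : Δ I → Concept
    literals d = ⋀ (map (literal d) (cnames S))

    -- Hintikka-style concepts describing `d` up to k rounds of the bisimulation game; finite
    -- outdegree keeps the conjunctions finite.
    χ : ℕ → Δ I → Concept
    moves : ℕ → Δ I → RName → Concept

    χ zero    d = literals d
    χ (suc k) d = literals d ⊓ ⋀ (map (moves k d) (rnames S))

    moves k d r =
      ⋀ (map (λ e → ex r (χ k e)) (successors r d)) ⊓
      -- This is the value restriction ∀r.⨆ₑ `χ k e`, written without ∀ and ⊔.
      neg (ex r (⋀ (map (λ e → neg (χ k e)) (successors r d))))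

    ⋀-map-intro : ∀ {A : Set} {J y} (f : A → Concept) xs →
      (∀ {x} → x ∈ xs → ⟦ f x ⟧ J y) → ⟦ ⋀ (map f xs) ⟧ J y
    ⋀-map-intro f xs h =
      ⋀-intro (map f xs) λ i → let (x , x∈ , eq) = ∈-map⁻ f i in subst (λ C → ⟦ C ⟧ _ _) (sym eq) (h x∈)

    ⋀-map-elim : ∀ {A : Set} {J y x} (f : A → Concept) xs →
      ⟦ ⋀ (map f xs) ⟧ J y → x ∈ xs → ⟦ f x ⟧ J y
    ⋀-map-elim f xs h i = ⋀-elim (map f xs) h (∈-map⁺ f i)

    ⋀-map-small : ∀ {A : Set} {k} (f : A → Concept) xs →
      (∀ {x} → x ∈ xs → Small S k (f x)) → Small S k (⋀ (map f xs))
    ⋀-map-small f xs h =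
      small-⋀ S (map f xs) λ i → let (x , x∈ , eq) = ∈-map⁻ f i in subst (Small S _) (sym eq) (h x∈)

    χ-holds : ∀ k d → ⟦ χ k d ⟧ I d
    χ-holds zero    d = ⋀-map-intro (literal d) (cnames S) λ _ → literal-holds d _
    χ-holds (suc k) d =
      ⋀-map-intro (literal d) (cnames S) (λ _ → literal-holds d _) ,
      ⋀-map-intro (moves k d) (rnames S) λ {r} _ →
        ⋀-map-intro (λ e → ex r (χ k e)) (successors r d) (λ {e} i → e , ∈-successors⁻ i , χ-holds k e) ,
        λ (e , re , n) →
          ⋀-map-elim (λ e → neg (χ k e)) (successors r d) n (∈-successors⁺ re) (χ-holds k e)

    χ-small : ∀ k d → Small S k (χ k d)
    χ-small zero    d = ⋀-map-small (literal d) (cnames S) literal-small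
    χ-small (suc k) d =
      small-⊓ S
        (⋀-map-small (literal d) (cnames S) (small-≤ S z≤n ∘ literal-small))
        (⋀-map-small (moves k d) (rnames S) λ {r} r∈ →
          small-⊓ S
            (⋀-map-small (λ e → ex r (χ k e)) (successors r d)
              λ {e} _ → small-ex S r∈ (χ-small k e))
            (small-neg S (small-ex S r∈
              (⋀-map-small (λ e → neg (χ k e)) (successors r d) λ {e} _ → small-neg S (χ-small k e)))))

    χ⇒bis : ∀ k {d J y} → ⟦ χ k d ⟧ J y → Bis S I J k d y
    χ⇒bis zero {d} h = λ A∈ → literal-decides d _ (⋀-map-elim (literal d) (cnames S) h A∈)
    χ⇒bis (suc k) {d} {J} {y} (h , h′) =
      (λ A∈ → literal-decides d _ (⋀-map-elim (literal d) (cnames S) h A∈)) ,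
      (λ {r} r∈ re →
        let (y′ , re′ , c) = ⋀-map-elim (λ e → ex r (χ k e)) (successors r d)
                               (proj₁ (⋀-map-elim (moves k d) (rnames S) h′ r∈)) (∈-successors⁺ re)
        in y′ , re′ , χ⇒bis k c) ,
      -- Were `y′` matched by no successor of `d`, it would refute every `χ k e`, which the second
      -- conjunct of `moves` forbids.
      λ {r} r∈ {y′} re′ → dne λ none →
        proj₂ (⋀-map-elim (moves k d) (rnames S) h′ r∈)
          (y′ , re′ , ⋀-map-intro (λ e → neg (χ k e)) (successors r d)
            λ {e} i c → none (e , ∈-successors⁻ i , χ⇒bis k c))

  -- Finitely many types and the finite model property.

  representatives : ∀ cl (P : Pointed → Set) →
    Σ[ ps ∈ List Pointed ] ((∀ {p} → p ∈ ps → P p) ×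
      (∀ q → P q → Σ[ p ∈ Pointed ] (p ∈ ps × Agree cl q p)))
  representatives [] P with lem {P = Σ Pointed P}
  ... | yes (p , h) = p ∷ [] , (λ { (here refl) → h }) , λ _ _ → p , here refl , λ ()
  ... | no none     = [] , (λ ()) , λ q h → contradiction (q , h) none
  representatives (C ∷ cl) P =
    -- The class `P` is split by the truth value of `C`; once `cl` is exhausted a single point
    -- represents whatever remains.
    let (ps , sound , complete)    = representatives cl (λ p → P p × p ⊩ C)
        (ps′ , sound′ , complete′) = representatives cl (λ p → P p × ¬ p ⊩ C)
    in ps ++ ps′
     , (λ i → [ proj₁ ∘ sound , proj₁ ∘ sound′ ]′ (∈-++⁻ ps i))
     , λ q h → case-C ps ps′ sound sound′ complete complete′ q h lem
    where
    case-C : ∀ ps ps′ →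
      (∀ {p} → p ∈ ps → P p × p ⊩ C) → (∀ {p} → p ∈ ps′ → P p × ¬ p ⊩ C) →
      (∀ q → P q × q ⊩ C → Σ[ p ∈ Pointed ] (p ∈ ps × Agree cl q p)) →
      (∀ q → P q × ¬ q ⊩ C → Σ[ p ∈ Pointed ] (p ∈ ps′ × Agree cl q p)) →
      ∀ q → P q → Dec (q ⊩ C) → Σ[ p ∈ Pointed ] (p ∈ ps ++ ps′ × Agree (C ∷ cl) q p)
    case-C ps ps′ s s′ c c′ q h (yes y) =
      let (p , i , a) = c q (h , y) in
      p , ∈-++⁺ˡ i , λ { (here refl) → (λ _ → proj₂ (s i)) , (λ _ → y) ; (there j) → a j }
    case-C ps ps′ s s′ c c′ q h (no n) =
      let (p , i , a) = c′ q (h , n) in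
      p , ∈-++⁺ʳ ps i ,
      λ { (here refl) → (λ y → contradiction y n) , (λ y → contradiction y (proj₂ (s′ i))) ; (there j) → a j }

  module Types (T : TBox) {cl} (clo : Closed cl) (cov : Covers cl T) where

    private reps = representatives cl (ModelPoint T)

    -- Pointed interpretations live in `Set₁` and cannot form a domain, so indices of the
    -- representatives are used instead.
    Type : Set
    Type = Fin (length (proj₁ reps))

    point : Type → Pointed
    point = lookup (proj₁ reps)

    point-model : ∀ u → ModelPoint T (point u)
    point-model u = proj₁ (proj₂ reps) (∈-lookup u)

    typeOf : ∀ p → ModelPoint T p → Σ[ u ∈ Type ] Agree cl p (point u)
    typeOf p mod =
      let (q , i , a) = proj₂ (proj₂ reps) p mod
      in index i , subst (Agree cl p) (lookup-index i) a

    -- The successor found in the interpretation of `point u` is itself a point of a model of `T`,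
    -- hence has a type.
    point-witness : ∀ {r C} u → ex r C ∈ cl → point u ⊩ ex r C →
      Σ[ v ∈ Type ] (Compat cl r (point u) (point v) × point v ⊩ C)
    point-witness u i (e , re , c) =
      let (v , a) = typeOf (_ , e) (point-model u) in
      v , step-compat clo re (λ _ → id , id) a , proj₁ (a (clo i (here refl))) c

    typeModel : Interp
    typeModel = record
      { Δ    = Type
      ; conc = λ A u → point u ⊩ atom A
      ; role = λ r u v → Compat cl r (point u) (point v)
      }

    typeModel-truth : ∀ u → Agree cl (typeModel , u) (point u)
    typeModel-truth = truth clo typeModel point (λ _ _ → id , id) id (λ i u → point-witness u i)

    typeModel-model : IsModel typeModel T
    typeModel-model = truth-model clo typeModel point (λ _ _ → id , id) id (λ i u → point-witness u i) cov point-model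

  FiniteSat : TBox → Concept → Set₁
  FiniteSat T C = Σ[ J ∈ Interp ] (IsModel J T ×
    (Σ[ l ∈ List (Δ J) ] ∀ x → x ∈ l) × Σ[ d ∈ Δ J ] ⟦ C ⟧ J d)

  finite-model-property : ∀ T C → Sat T C → FiniteSat T C
  finite-model-property T C (I , mod , d , c) =
    let (u , a) = typeOf (I , d) mod
        C∈ = extra∈closure {C ∷ []} {T} {C} (here refl)
    in typeModel , typeModel-model , (allFin _ , ∈-allFin) , u ,
       proj₂ (typeModel-truth u C∈) (proj₁ (a C∈) c)
    where open Types T (closure-closed (C ∷ []) T) (closure-covers (C ∷ []) T)

  -- If the head fails at some `k₀`, it fails at all larger stages by antitonicity, so the witnesses
  -- for `k ⊔ k₀` lie in the tail.
  pigeonhole : ∀ {A : Set} (xs : List A) (P : ℕ → A → Set₁) →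
    (∀ {j k a} → j ≤ k → P k a → P j a) →
    (∀ k → Σ[ a ∈ A ] (a ∈ xs × P k a)) → Σ[ a ∈ A ] (∀ k → P k a)
  pigeonhole [] P anti h with () ← proj₁ (proj₂ (h 0))
  pigeonhole {A} (x ∷ xs) P anti h with lem {P = Σ[ k ∈ ℕ ] ¬ P k x}
  ... | no none     = x , λ k → dne λ n → none (k , n)
  ... | yes (k₀ , n) = pigeonhole xs P anti λ k → later k (h (k ⊔ k₀))
    where
    later : ∀ k → Σ[ a ∈ A ] (a ∈ x ∷ xs × P (k ⊔ k₀) a) → Σ[ a ∈ A ] (a ∈ xs × P k a)
    later k (_ , here refl , p) = contradiction (anti (m≤n⊔m k k₀) p) n
    later k (a , there i , p)   = a , i , anti (m≤m⊔n k k₀) p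

  -- An element d is paired with a type u when, for every k, u is realised in a
  -- model of T at a point k-bisimilar to d; finite branching and the pigeonhole
  -- principle supply successor pairs that work for all k at once.
  module Saturation (T : TBox) (S : Signature) (I : Interp) (fin : FiniteOutdegree I) where

    cl : List Concept
    cl = closure (map atom (cnames S)) T

    open Types T {cl} (closure-closed (map atom (cnames S)) T) (closure-covers (map atom (cnames S)) T)

    clo : Closed cl
    clo = closure-closed (map atom (cnames S)) T

    Near : ℕ → Δ I → Type → Set₁
    Near k d u = Σ[ p ∈ Pointed ]
      (ModelPoint T p × Bis S I (proj₁ p) k d (proj₂ p) × Agree cl p (point u))

    near-≤ : ∀ {j k d u} → j ≤ k → Near k d u → Near j d u
    near-≤ j≤k (p , mod , b , a) = p , mod , bis-≤ S j≤k b , a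

    Good : Δ I → Type → Set₁
    Good d u = ∀ k → Near k d u

    good-forth : ∀ {r d d′ u} → Good d u → r ∈ rnames S → role I r d d′ →
      Σ[ u′ ∈ Type ] (Compat cl r (point u) (point u′) × Good d′ u′)
    good-forth {r} {d} {d′} {u} g r∈ re =
      let (u′ , h) = pigeonhole (allFin _) Q (λ j≤k (c , n) → c , near-≤ j≤k n) next
      in u′ , proj₁ (h 0) , proj₂ ∘ h
      where
      Q : ℕ → Type → Set₁
      Q k u′ = Compat cl r (point u) (point u′) × Near k d′ u′
      next : ∀ k → Σ[ u′ ∈ Type ] (u′ ∈ allFin _ × Q k u′)
      next k =
        -- Stage `suc k` is used because the move to `d′` spends one round.
        let ((J , e) , mod , (_ , forth , _) , a) = g (suc k)
            (e′ , re′ , b) = forth r∈ re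
            (u′ , a′) = typeOf (J , e′) mod
        in u′ , ∈-allFin u′ , step-compat clo re′ a a′ , (J , e′) , mod , b , a′

    -- Both the successor of `d` and its type may vary with k, so the pigeonhole principle is
    -- applied to pairs; finite outdegree makes these finitely many.
    good-witness : ∀ {r C d u} → Good d u → r ∈ rnames S → ex r C ∈ cl → point u ⊩ ex r C →
      Σ[ d′ ∈ Δ I ] Σ[ u′ ∈ Type ]
        (role I r d d′ × Compat cl r (point u) (point u′) × point u′ ⊩ C × Good d′ u′)
    good-witness {r} {C} {d} {u} g r∈ i h =
      let ((d′ , u′) , q) =
            pigeonhole (cartesianProduct (proj₁ (fin d)) (allFin _)) Q
              (λ j≤k (re , c , p , n) → re , c , p , near-≤ j≤k n) next
          (re , c , p , _) = q 0
      in d′ , u′ , re , c , p , λ k → proj₂ (proj₂ (proj₂ (q k)))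
      where
      Q : ℕ → Δ I × Type → Set₁
      Q k (d′ , u′) =
        role I r d d′ × Compat cl r (point u) (point u′) × point u′ ⊩ C × Near k d′ u′
      next : ∀ k → Σ[ x ∈ Δ I × Type ] (x ∈ cartesianProduct (proj₁ (fin d)) (allFin _) × Q k x)
      next k =
        let ((J , e) , mod , (_ , _ , back) , a) = g (suc k)
            (e′ , re′ , c) = proj₂ (a i) h
            (d′ , re , b) = back r∈ re′
            (u′ , a′) = typeOf (J , e′) mod
        in (d′ , u′) , ∈-cartesianProduct⁺ (proj₂ (fin d) re) (∈-allFin u′) ,
           re , step-compat clo re′ a a′ , proj₁ (a′ (clo i (here refl))) c , (J , e′) , mod , b , a′

    -- True (lem {P = Good d u}) shrinks Good d u from Set₁ to Set.
    data Element : Set where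
      paired : ∀ d u → True (lem {P = Good d u}) → Element
      plain  : Type → Element

    type : Element → Type
    type (paired _ u _) = u
    type (plain u)      = u

    -- Along roles of Σ, a paired element moves only together with `I`. It leaves for plain types
    -- only along other roles, on which a Σ-bisimulation imposes nothing.
    Edge : RName → Element → Element → Set
    Edge r (paired d u _) (paired d′ u′ _) =
      r ∈ rnames S × role I r d d′ × Compat cl r (point u) (point u′)
    Edge r (paired d u _) (plain u′)       = ¬ (r ∈ rnames S) × Compat cl r (point u) (point u′)
    Edge r (plain u)      (paired _ _ _)   = ⊥
    Edge r (plain u)      (plain u′)       = Compat cl r (point u) (point u′)

    saturated : Interp
    saturated = record { Δ = Element ; conc = λ A x → point (type x) ⊩ atom A ; role = Edge }

    edge-compat : ∀ {r} x y → Edge r x y → Compat cl r (point (type x)) (point (type y))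
    edge-compat (paired _ _ _) (paired _ _ _) (_ , _ , c) = c
    edge-compat (paired _ _ _) (plain _)      (_ , c)     = c
    edge-compat (plain _)      (plain _)      c           = c

    edge-witness : ∀ {r C} → ex r C ∈ cl → ∀ x → point (type x) ⊩ ex r C →
      Σ[ y ∈ Element ] (Edge r x y × point (type y) ⊩ C)
    edge-witness i (plain u) h =
      let (v , c , p) = point-witness u i h in plain v , c , p
    edge-witness {r} i (paired d u g) h with lem {P = r ∈ rnames S}
    ... | no r∉ = let (v , c , p) = point-witness u i h in plain v , (r∉ , c) , p
    ... | yes r∈ =
      let (d′ , u′ , re , c , p , g′) = good-witness (toWitness g) r∈ i h
      in paired d′ u′ (fromWitness g′) , (r∈ , re , c) , p

    saturated-model : IsModel saturated T
    saturated-model =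
      truth-model clo saturated (point ∘ type) (λ _ _ → id , id) (λ {_} {x} {y} → edge-compat x y)
        edge-witness (closure-covers (map atom (cnames S)) T) (point-model ∘ type)

    Projection : Δ I → Element → Set
    Projection d (paired d′ _ _) = d ≡ d′
    Projection d (plain _)       = ⊥

    projection-bisim : IsSigBisim S I saturated Projection
    projection-bisim {d} {paired d u g} refl = atoms , forth , back
      where
      atoms : SameAtoms S I saturated d (paired d u g)
      atoms A∈ =
        -- Stage 0 already fixes the atoms, and `cl` was built to contain every concept name of Σ.
        let (_ , _ , b , a) = toWitness g 0
        in a (extra∈closure {T = T} (∈-map⁺ atom A∈)) ⟷∘ b A∈
      forth : Forth S I saturated Projection d (paired d u g)
      forth r∈ re =
        let (u′ , c , g′) = good-forth (toWitness g) r∈ re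
        in paired _ u′ (fromWitness g′) , (r∈ , re , c) , refl
      back : Back S I saturated Projection d (paired d u g)
      back r∈ {paired d′ _ _} (_ , re , _) = d′ , re , refl
      back r∈ {plain _}       (r∉ , _)     = contradiction r∈ r∉

    -- Satisfiability of `χ k d` with `T` gives a type near `d` at each stage k; one type recurs at
    -- all stages and is good, so `d` has a paired counterpart in `saturated`.
    locally-sat⇒satExSim : ∀ d → (∀ C → IsSigConcept S C → ⟦ C ⟧ I d → Sat T C) → SatExSim S T I d
    locally-sat⇒satExSim d sat =
      let (u , g) = pigeonhole (allFin _) (λ k u → Near k d u) near-≤ approx
      in saturated , saturated-model , paired d u (fromWitness g) , Projection , refl , projection-bisim
      where
      open Characteristic S I fin
      approx : ∀ k → Σ[ u ∈ Type ] (u ∈ allFin _ × Near k d u)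
      approx k =
        let (J , mod , e , x) = sat (χ k d) (sig (χ-small k d)) (χ-holds k d)
            (u , a) = typeOf (J , e) mod
        in u , ∈-allFin u , (J , e) , mod , χ⇒bis k x , a

  -- From (∗ₘ) to the failure of the interpolant

  path-snoc : ∀ {I k r d e f} → Path I k d e → role I r e f → Path I (suc k) d f
  path-snoc here       re = step re here
  path-snoc (step p q) re = step p (path-snoc q re)

  sameUpTo⇒bis : ∀ S {m I₁ ρ₁ I₂ ρ₂} → SameUpTo m I₁ ρ₁ I₂ ρ₂ → Bis S I₁ I₂ m ρ₁ ρ₂
  sameUpTo⇒bis S {m} {I₁} {ρ₁} {I₂} {ρ₂} same =
    subst (Bis S I₁ I₂ m ρ₁) root (go m 0 (≤-reflexive (+-identityʳ m)) here (subst (Path I₂ 0 ρ₂) (sym root) here))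
    where
    open SameUpTo same
    -- Rounds left plus depth never exceed `m`, so every element met in the game lies in the shared
    -- part.
    go : ∀ k j {d} → k + j ≤ m → Path I₁ j ρ₁ d → Path I₂ j ρ₂ (to d) → Bis S I₁ I₂ k d (to d)
    go zero    j j≤m p q = λ _ → conc-eq (j , j≤m , p)
    go (suc k) j {d} k+j<m p q = (λ _ → conc-eq wd) , forth , back
      where
      k+sj≤m : k + suc j ≤ m
      k+sj≤m = subst (_≤ m) (sym (+-suc k j)) k+j<m
      sj≤m : suc j ≤ m
      sj≤m = ≤-trans (m≤n+m (suc j) k) k+sj≤m
      wd : Within I₁ m ρ₁ d
      wd = j , <⇒≤ sj≤m , p
      forth : Forth S I₁ I₂ (Bis S I₁ I₂ k) d (to d)
      forth _ {x′} re =
        let p′  = path-snoc p re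
            re′ = proj₁ (role-eq wd (suc j , sj≤m , p′)) re
        in to x′ , re′ , go k (suc j) k+sj≤m p′ (path-snoc q re′)
      back : Back S I₁ I₂ (Bis S I₁ I₂ k) d (to d)
      back {r} _ {y′} re =
        let q′  = path-snoc q re
            wy  = suc j , sj≤m , q′
            eq  = to-from wy
            re′ = subst (role I₂ r (to d)) (sym eq) re
            re″ = proj₂ (role-eq wd (from-in wy)) re′
        in from y′ , re″ ,
           subst (Bis S I₁ I₂ k (from y′)) eq
             (go k (suc j) k+sj≤m (path-snoc p re″) (path-snoc q re′))

  satExSim-path : ∀ {S T I k d e} → OnlySig S I → Path I k d e → SatExSim S T I d → SatExSim S T I e
  satExSim-path o here        s = s
  satExSim-path {S} o (step re p) s = satExSim-path o p (satExSim-step S (proj₂ o _ _ _ re) re s)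

  star⇒¬interpolant : ∀ {T S m Cs} → IsCmf S m Cs → StarCond S T m →
    ¬ IsUniformInterpolant (TSigm T Cs) S T
  star⇒¬interpolant {T} {S} {m} {Cs} (small-Cs , _)
    (I₁ , ρ₁ , I₂ , ρ₂ , _ , _ , (tree₂ , only₂) , fin₂ , same , sat₁ , unsat₂ , below) (_ , _ , entails) =
    unsat₂ (Saturation.locally-sat⇒satExSim T S I₂ fin₂ ρ₂ λ C sC c →
      dne λ unsat →
        -- With `neg top` as ⊥, an unsatisfiable `C` yields a Σ-inclusion entailed by `T` but
        -- violated at `ρ₂`.
        proj₁ (entails (C , neg top) (sC , (λ ()) , λ ())) (unsat⇒⊨ {C = C} {neg top} unsat) I₂ model ρ₂ c tt)
    where
    b : Bis S I₁ I₂ m ρ₁ ρ₂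
    b = sameUpTo⇒bis S same
    transfer : ∀ {C} → C ∈ Cs → ⟦ C ⟧ I₁ ρ₁ ⟷ ⟦ C ⟧ I₂ ρ₂
    transfer {C} i = let (s , u) = small-Cs i in bis-concept S m C (small s u) b
    -- At the root, concepts of depth at most `m` are evaluated in `I₁`, where (2) applies. Any
    -- other element lies at or below a successor of the root, where (4) applies.
    model : IsModelS I₂ (TSigm T Cs)
    model (C , D) ((iC , iD) , ent) d c with IsTree.reachable tree₂ d
    ... | _ , here =
      proj₁ (transfer iD)
        (satExSim-entailed S {C = C} {D} (proj₁ (small-Cs iC)) (proj₁ (small-Cs iD)) ent sat₁
          (proj₂ (transfer iC) c))
    ... | _ , step re p =
      satExSim-entailed S {C = C} {D} (proj₁ (small-Cs iC)) (proj₁ (small-Cs iD)) ent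
        (satExSim-path only₂ p (below re)) c

  -- Tree unravelling of a common product skeleton

  -- A node is the word of edges leading to it, last edge first.
  Word : Set → Set
  Word X = List (RName × X)

  end : ∀ {X} → X → Word X → X
  end x₀ []            = x₀
  end x₀ ((_ , x) ∷ _) = x

  module Unravelling (X : Set) (E : X → RName → X → Set) (c : CName → X → Set) (x₀ : X) where

    base : Interp
    base = record { Δ = X ; conc = c ; role = λ r x y → E x r y }

    -- `True` makes validity proof-irrelevant, so that nodes are equal as soon as their words are.
    Valid : Word X → Set
    Valid []            = ⊤
    Valid ((r , x) ∷ w) = True (lem {P = E (end x₀ w) r x}) × Valid w

    valid-irrelevant : ∀ w (v v′ : Valid w) → v ≡ v′
    valid-irrelevant []      _ _ = refl
    valid-irrelevant (_ ∷ w) (t , v) (t′ , v′) = cong₂ _,_ (T-irrelevant t t′) (valid-irrelevant w v v′)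

    Node : Set
    Node = Σ (Word X) Valid

    node-≡ : ∀ {p q : Node} → proj₁ p ≡ proj₁ q → p ≡ q
    node-≡ {w , _} refl = cong (w ,_) (valid-irrelevant w _ _)

    tree : Interp
    tree = record
      { Δ    = Node
      ; conc = λ A p → c A (end x₀ (proj₁ p))
      ; role = λ r p q → Σ[ x ∈ X ] (proj₁ q ≡ (r , x) ∷ proj₁ p)
      }

    ρ : Node
    ρ = [] , tt

    path-to : ∀ w (v : Valid w) → Path tree (length w) ρ (w , v)
    path-to []            v       = here
    path-to ((r , x) ∷ w) (t , v) = path-snoc (path-to w v) (x , refl)

    path-length : ∀ {k p q} → Path tree k p q → length (proj₁ q) ≡ k + length (proj₁ p)
    path-length here = refl
    path-length (step {k} {d = p} (_ , refl) q) = trans (path-length q) (+-suc k (length (proj₁ p)))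

    within⇒length≤ : ∀ {m p} → Within tree m ρ p → length (proj₁ p) ≤ m
    within⇒length≤ (k , k≤m , p) = subst (_≤ _) (sym (trans (path-length p) (+-identityʳ k))) k≤m

    tree-isTree : IsTree tree ρ
    tree-isTree = record
      { reachable  = λ (w , v) → length w , path-to w v
      ; rootNoPred = λ ()
      ; uniquePred = λ { (_ , refl) (_ , refl) → refl , node-≡ refl }
      }

    tree-isSigTree : ∀ S → OnlySig S base → IsSigTree S tree ρ
    tree-isSigTree S (only-c , only-r) =
      tree-isTree , (λ A p → only-c A (end x₀ (proj₁ p))) ,
      λ { r _ (_ , t , _) (x , refl) → only-r r _ x (toWitness t) }

    valid-nodes : List (Word X) → List Node
    valid-nodes [] = []
    valid-nodes (w ∷ ws) with lem {P = Valid w}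
    ... | yes v = (w , v) ∷ valid-nodes ws
    ... | no  _ = valid-nodes ws

    ∈-valid-nodes : ∀ {w} (v : Valid w) ws → w ∈ ws → (w , v) ∈ valid-nodes ws
    ∈-valid-nodes v (w ∷ ws) i with lem {P = Valid w} | i
    ... | yes _ | here refl = here (node-≡ refl)
    ... | yes _ | there j   = there (∈-valid-nodes v ws j)
    ... | no ¬v | here refl = contradiction v ¬v
    ... | no  _ | there j   = ∈-valid-nodes v ws j

    tree-finite : (next : X → List (RName × X)) → (∀ {x r y} → E x r y → (r , y) ∈ next x) →
      FiniteOutdegree tree
    tree-finite next complete (w , _) =
      valid-nodes (map (_∷ w) (next (end x₀ w))) ,
      λ { {e = _ , v@(t , _)} (x , refl) →
            ∈-valid-nodes v (map (_∷ w) (next (end x₀ w))) (∈-map⁺ (_∷ w) (complete (toWitness t))) }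

    tree-bisimilar : ∀ S → SigBisimilar S tree ρ base x₀
    tree-bisimilar S = (λ p x → end x₀ (proj₁ p) ≡ x) , refl , λ { {w , v} refl →
      (λ _ → id , id) ,
      (λ { _ {_ , t , _} (x , refl) → x , toWitness t , refl }) ,
      λ { {r} _ {x} e → ((r , x) ∷ w , fromWitness e , v) , (x , refl) , refl } }

  -- Two m-bisimilar points are unravelled together: the state (x , y , k) holds
  -- k-bisimilar points, and at level 0 the tree continues along one of the two
  -- interpretations only, the other coordinate being frozen.
  module Product (S : Signature) (A B : Interp)
    (finA : FiniteOutdegree A) (finB : FiniteOutdegree B)
    (m : ℕ) (a₀ : Δ A) (b₀ : Δ B) (bis₀ : Bis S A B m a₀ b₀) where

    State : Set
    State = Δ A × Δ B × ℕ

    Tail : Set₁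
    Tail = RName → Δ A × Δ B → Δ A × Δ B → Set

    Edge : Tail → State → RName → State → Set
    Edge F (x , y , zero)  r (x′ , y′ , k′) = r ∈ rnames S × k′ ≡ 0 × F r (x , y) (x′ , y′)
    Edge F (x , y , suc k) r (x′ , y′ , k′) =
      r ∈ rnames S × k′ ≡ k × role A r x x′ × role B r y y′ × Bis S A B k x′ y′

    left right : Tail
    left  r (x , y) (x′ , y′) = role A r x x′ × y′ ≡ y
    right r (x , y) (x′ , y′) = role B r y y′ × x′ ≡ x

    leftAtoms rightAtoms : CName → State → Set
    leftAtoms  N (x , _ , _) = N ∈ cnames S × conc A N x
    rightAtoms N (_ , y , _) = N ∈ cnames S × conc B N y

    s₀ : State
    s₀ = a₀ , b₀ , m

    module L = Unravelling State (Edge left) leftAtoms s₀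
    module R = Unravelling State (Edge right) rightAtoms s₀

    edge-sig : ∀ F s {r s′} → Edge F s r s′ → r ∈ rnames S
    edge-sig F (_ , _ , zero)  = proj₁
    edge-sig F (_ , _ , suc _) = proj₁

    isSigTreeL : IsSigTree S L.tree L.ρ
    isSigTreeL = L.tree-isSigTree S ((λ _ _ → proj₁) , λ r s s′ → edge-sig left s)

    isSigTreeR : IsSigTree S R.tree R.ρ
    isSigTreeR = R.tree-isSigTree S ((λ _ _ → proj₁) , λ r s s′ → edge-sig right s)

    next : State → Word State
    next (x , y , k) =
      cartesianProduct (rnames S)
        -- A frozen coordinate stays put, hence the added `x` and `y`; `pred` counts down and fixes
        -- level 0.
        (cartesianProduct (x ∷ proj₁ (finA x)) (cartesianProduct (y ∷ proj₁ (finB y)) (pred k ∷ [])))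

    edge-next : ∀ F →
      (∀ {r x y x′ y′} → F r (x , y) (x′ , y′) → x′ ∈ x ∷ proj₁ (finA x) × y′ ∈ y ∷ proj₁ (finB y)) →
      ∀ {s r s′} → Edge F s r s′ → (r , s′) ∈ next s
    edge-next F near {_ , _ , zero} (r∈ , refl , f) =
      let (x∈ , y∈) = near f in
      ∈-cartesianProduct⁺ r∈ (∈-cartesianProduct⁺ x∈ (∈-cartesianProduct⁺ y∈ (here refl)))
    edge-next F near {x , y , suc k} (r∈ , refl , a , b , _) =
      ∈-cartesianProduct⁺ r∈ (∈-cartesianProduct⁺ (there (proj₂ (finA x) a))
        (∈-cartesianProduct⁺ (there (proj₂ (finB y) b)) (here refl)))

    finiteL : FiniteOutdegree L.tree
    finiteL = L.tree-finite next λ {s} →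
      edge-next left (λ { (a , refl) → there (proj₂ (finA _) a) , here refl }) {s}

    finiteR : FiniteOutdegree R.tree
    finiteR = R.tree-finite next λ {s} →
      edge-next right (λ { (b , refl) → here refl , there (proj₂ (finB _) b) }) {s}

    -- Once one coordinate is frozen the two drift apart, so bisimilarity is maintained only at
    -- positive levels.
    Inv : State → Set
    Inv (x , y , zero)  = ⊤
    Inv (x , y , suc k) = Bis S A B (suc k) x y

    bis⇒inv : ∀ k {x y} → Bis S A B k x y → Inv (x , y , k)
    bis⇒inv zero    _ = tt
    bis⇒inv (suc k) b = b

    -- The first projection works: at positive levels `forth` supplies the accompanying move in `B`,
    -- and at level 0 `A` moves alone.
    bisimilarL : SigBisimilar S L.tree L.ρ A a₀
    bisimilarL = bisimilar-trans S (L.tree-bisimilar S) (Z , (refl , bis⇒inv m bis₀) , bisim)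
      where
      Z : State → Δ A → Set
      Z s x = proj₁ s ≡ x × Inv s
      bisim : IsSigBisim S L.base A Z
      bisim {x , y , zero} (refl , _) =
        (λ N∈ → proj₂ , (N∈ ,_)) ,
        (λ { _ (_ , refl , a , _) → _ , a , refl , tt }) ,
        λ r∈ a → (_ , y , zero) , (r∈ , refl , a , refl) , refl , tt
      bisim {x , y , suc k} (refl , (_ , forth , _)) =
        (λ N∈ → proj₂ , (N∈ ,_)) ,
        (λ { _ (_ , refl , a , _ , b) → _ , a , refl , bis⇒inv k b }) ,
        λ r∈ a → let (y′ , b , bis) = forth r∈ a
                 in (_ , y′ , k) , (r∈ , refl , a , b , bis) , refl , bis⇒inv k bis

    bisimilarR : SigBisimilar S R.tree R.ρ B b₀
    bisimilarR = bisimilar-trans S (R.tree-bisimilar S) (Z , (refl , bis⇒inv m bis₀) , bisim)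
      where
      Z : State → Δ B → Set
      Z s y = proj₁ (proj₂ s) ≡ y × Inv s
      bisim : IsSigBisim S R.base B Z
      bisim {x , y , zero} (refl , _) =
        (λ N∈ → proj₂ , (N∈ ,_)) ,
        (λ { _ (_ , refl , b , _) → _ , b , refl , tt }) ,
        λ r∈ b → (x , _ , zero) , (r∈ , refl , b , refl) , refl , tt
      bisim {x , y , suc k} (refl , (_ , _ , back)) =
        (λ N∈ → proj₂ , (N∈ ,_)) ,
        (λ { _ (_ , refl , _ , b , bis) → _ , b , refl , bis⇒inv k bis }) ,
        λ r∈ b → let (x′ , a , bis) = back r∈ b
                 in (x′ , _ , k) , (r∈ , refl , a , b , bis) , refl , bis⇒inv k bis

    -- Countdown plus depth is `m`. Unlike `Inv`, this includes 0-bisimilarity at level 0, which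
    -- equality of the labels at depth `m` relies on.
    Level : State → ℕ → Set
    Level (x , y , k) n = k + n ≡ m × Bis S A B k x y

    -- Above level 0 edges do not depend on the tail.
    module Skeleton (F G : Tail) (c c′ : CName → State → Set) where
      private
        module U = Unravelling State (Edge F) c s₀
        module V = Unravelling State (Edge G) c′ s₀

      skeleton : ∀ w → U.Valid w → length w ≤ m → V.Valid w × Level (end s₀ w) (length w)
      skeleton [] _ _ = tt , +-identityʳ m , bis₀
      skeleton ((r , s′) ∷ w) (t , v) n<m =
        let (v′ , lev) = skeleton w v (<⇒≤ n<m)
            (e , lev′) = extend (end s₀ w) s′ lev n<m (toWitness t)
        in (fromWitness e , v′) , lev′
        where
        extend : ∀ s s′ {n r} → Level s n → n < m → Edge F s r s′ → Edge G s r s′ × Level s′ (suc n)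
        -- Within the skeleton, level 0 occurs only at depth `m`, where no further step is taken.
        extend (_ , _ , zero)  _ (refl , _) n<m _ = contradiction n<m (<-irrefl refl)
        extend (_ , _ , suc k) _ {n} (eq , _) _ (r∈ , refl , a , b , bis) =
          (r∈ , refl , a , b , bis) , trans (+-suc k n) eq , bis

      transport : U.Node → V.Node
      transport (w , _) with lem {P = V.Valid w}
      ... | yes v = w , v
      -- A default value, never reached by nodes of depth at most `m`.
      ... | no  _ = V.ρ

      transport-word : ∀ p → V.Valid (proj₁ p) → proj₁ (transport p) ≡ proj₁ p
      transport-word (w , _) v with lem {P = V.Valid w}
      ... | yes _ = refl
      ... | no ¬v = contradiction v ¬v

      module _ {p} (within : Within U.tree m U.ρ p) where

        in-skeleton : V.Valid (proj₁ p) × Level (end s₀ (proj₁ p)) (length (proj₁ p))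
        in-skeleton = skeleton (proj₁ p) (proj₂ p) (U.within⇒length≤ within)

        same-word : proj₁ (transport p) ≡ proj₁ p
        same-word = transport-word p (proj₁ in-skeleton)

        transport-within : Within V.tree m V.ρ (transport p)
        transport-within =
          _ , subst (_≤ m) (sym (cong length same-word)) (U.within⇒length≤ within) ,
          V.path-to (proj₁ (transport p)) (proj₂ (transport p))

    module LR = Skeleton left right leftAtoms rightAtoms
    module RL = Skeleton right left rightAtoms leftAtoms

    same : SameUpTo m L.tree L.ρ R.tree R.ρ
    same = record
      { to      = LR.transport
      ; from    = RL.transport
      ; to-in   = LR.transport-within
      ; from-in = RL.transport-within
      ; from-to = λ w → L.node-≡ (trans (RL.same-word (LR.transport-within w)) (LR.same-word w))
      ; to-from = λ w → R.node-≡ (trans (LR.same-word (RL.transport-within w)) (RL.same-word w))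
      ; root    = R.node-≡ (LR.transport-word L.ρ tt)
      ; conc-eq = λ {N} {p} w →
          let (_ , b) = proj₂ (LR.in-skeleton w) in
          subst (λ v → leftAtoms N (end s₀ (proj₁ p)) ⟷ rightAtoms N (end s₀ v)) (sym (LR.same-word w))
            ( (λ (N∈ , h) → N∈ , proj₁ (bis-atoms S _ b N∈) h)
            , (λ (N∈ , h) → N∈ , proj₂ (bis-atoms S _ b N∈) h))
      ; role-eq = λ wp wq →
          (λ (x , eq) → x , trans (LR.same-word wq) (trans eq (cong (_ ∷_) (sym (LR.same-word wp))))) ,
          λ (x , eq) → x , trans (sym (LR.same-word wq)) (trans eq (cong (_ ∷_) (LR.same-word wp)))
      }

    -- `SatExSim` is invariant under Σ-bisimilarity, so (2), (3) and (4) pass from `A` and `B` to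
    -- their unravellings, while (1) is `same`.
    star : ∀ {T} → SatExSim S T A a₀ → ¬ SatExSim S T B b₀ →
      (∀ {r b} → r ∈ rnames S → role B r b₀ b → SatExSim S T B b) → StarCond S T m
    star satA unsatB below =
      L.tree , L.ρ , R.tree , R.ρ , isSigTreeL , finiteL , isSigTreeR , finiteR , same ,
      satExSim-bisimilar S bisimilarL satA ,
      (λ sat → unsatB (satExSim-bisimilar S (bisimilar-sym S bisimilarR) sat)) ,
      λ {r} {d} re →
        let (Z , z , bs) = bisimilarR
            r∈ = proj₂ (proj₂ isSigTreeR) r R.ρ d re
            (b , rb , z′) = proj₁ (proj₂ (bs z)) r∈ {d} re
        in satExSim-bisimilar S (Z , z′ , λ {x} {y} → bs {x} {y}) (below r∈ rb)

  -- From the failure of the interpolant to (∗ₘ)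

  -- A fresh copy of `d₀` is placed above the disjoint union of the `J e`, with each successor `e`
  -- replaced by `pt e`.
  module Graft (I : Interp) (d₀ : Δ I) (J : Δ I → Interp) (pt : ∀ e → Δ (J e)) where

    data Vertex : Set where
      apex : Vertex
      at   : ∀ e → Δ (J e) → Vertex

    data Arrow (r : RName) : Vertex → Vertex → Set where
      enter  : ∀ {e} → role I r d₀ e → Arrow r apex (at e (pt e))
      inside : ∀ {e x y} → role (J e) r x y → Arrow r (at e x) (at e y)

    label : CName → Vertex → Set
    label A apex     = conc I A d₀
    label A (at e x) = conc (J e) A x

    graft : Interp
    graft = record { Δ = Vertex ; conc = label ; role = Arrow }

    at-bisimilar : ∀ S e x → SigBisimilar S graft (at e x) (J e) x
    at-bisimilar S e x = (λ v y → v ≡ at e y) , refl , λ { refl →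
      (λ _ → id , id) ,
      (λ { _ (inside ry) → _ , ry , refl }) ,
      λ _ ry → _ , inside ry , refl }

    -- One round is gained: the apex has the atoms of `d₀`, and its successors match those of `d₀`
    -- for k rounds.
    apex-bis : ∀ S k → (∀ e → Bis S I (J e) k e (pt e)) → Bis S I graft (suc k) d₀ apex
    apex-bis S k b =
      (λ _ → id , id) ,
      (λ { _ {e} re → at e (pt e) , enter re , at-pt e }) ,
      λ { _ (enter {e} re) → e , re , at-pt e }
      where
      at-pt : ∀ e → Bis S I graft k e (at e (pt e))
      at-pt e = bis-trans S k (b e)
        (bis-sym S k (bisimilar⇒bis S (at-bisimilar S e (pt e)) k))

    graft-finite : FiniteOutdegree I → (∀ e → FiniteOutdegree (J e)) → FiniteOutdegree graft
    graft-finite finI finJ apex =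
      map (λ e → at e (pt e)) (proj₁ (finI d₀)) ,
      λ { (enter re) → ∈-map⁺ (λ e → at e (pt e)) (proj₂ (finI d₀) re) }
    graft-finite finI finJ (at e x) =
      map (at e) (proj₁ (finJ e x)) , λ { (inside ry) → ∈-map⁺ (at e) (proj₂ (finJ e x) ry) }

  -- Satisfiability with the depth-m consequences, by induction on role depth.

  module _ {T : TBox} {S : Signature} {m : ℕ} {Cs : List Concept} (cmf : IsCmf S m Cs) where

    -- T_{Σ,m} as an actual finite list, so that the finite model property applies to it.
    shallow : TBox
    shallow = filter (λ α → lem {P = T ⊨ α}) (cartesianProduct Cs Cs)

    ∈-shallow⁺ : ∀ {α} → TSigm T Cs α → α ∈ shallow
    ∈-shallow⁺ ((i , j) , ent) = ∈-filter⁺ (λ _ → lem) (∈-cartesianProduct⁺ i j) ent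

    ∈-shallow⁻ : ∀ {α} → α ∈ shallow → TSigm T Cs α
    ∈-shallow⁻ i =
      let (j , ent) = ∈-filter⁻ (λ _ → lem) {xs = cartesianProduct Cs Cs} i
      in ∈-cartesianProduct⁻ Cs Cs j , ent

    -- Otherwise the members of `Cs` equivalent to `E` and to ⊥ would form an inclusion of `shallow`
    -- that excludes `E`.
    shallow-sat : ∀ {E} → Small S m E → Sat shallow E → Sat T E
    shallow-sat {E} (small s u) (I , mod , d , h) = dne λ unsat →
      let (D , D∈ , E≡D) = proj₂ cmf E s u
          (F , F∈ , ⊥≡F) = proj₂ cmf (neg top) ((λ ()) , λ ()) z≤n
          ent : T ⊨ (D , F)
          ent J modJ e x = ⊥-elim (unsat (J , (λ {α} → modJ {α}) , e , proj₂ (E≡D J e) x))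
      in proj₂ (⊥≡F I d) (mod (∈-shallow⁺ ((D∈ , F∈) , ent)) d (proj₁ (E≡D I d) h)) tt

    Preserved : ℕ → Set₁
    Preserved n = ∀ {E} → Small S n E → Sat shallow E → Sat T E

    preserved-suc : ¬ StarCond S T m → ∀ n → m ≤ n → Preserved n → Preserved (suc n)
    preserved-suc ¬star n m≤n ih {E} small-E sat = dne λ unsat → refute unsat (finite-model-property shallow E sat)
      where
      refute : ¬ Sat T E → ¬ FiniteSat shallow E
      refute unsat (I , mod , (l , all) , d₀ , h) =
        ¬star (Product.star S A.model graft A.finite (graft-finite finI J.finite) m A.centre apex bis-m
                 (A.model , A.isModel , A.centre , bisimilar-refl S) apex-unsat below)
        where
        finI : FiniteOutdegree I
        finI = fin-outdegree I l all

        open Characteristic S I finI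

        copy : ∀ k → Preserved k → ∀ e → FiniteCopy T S I k e
        copy k pres e =
          let (J , modJ , (lJ , allJ) , x , hx) =
                finite-model-property T (χ k e)
                  (pres (χ-small k e) (I , (λ {α} → mod {α}) , e , χ-holds k e))
          in record { isModel = modJ ; finite = fin-outdegree J lJ allJ ; bis = χ⇒bis k hx }

        -- The depth `m` copy of `d₀` becomes I₁; the depth `n` copies of its successors, given by
        -- the induction hypothesis, go below the apex of I₂.
        module A = FiniteCopy (copy m shallow-sat d₀)
        module J (e : Δ I) = FiniteCopy (copy n ih e)

        open Graft I d₀ J.model J.centre

        bis-apex : Bis S I graft (suc n) d₀ apex
        bis-apex = apex-bis S n J.bis

        bis-m : Bis S A.model graft m A.centre apex
        bis-m = bis-trans S m (bis-sym S m A.bis) (bis-≤ S (≤-trans m≤n (n≤1+n n)) bis-apex)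

        apex-unsat : ¬ SatExSim S T graft apex
        apex-unsat (K , modK , z , b) =
          unsat (K , modK , z ,
            -- `E` passes from `d₀` to the apex, which is what the gained round is for, and then
            -- into the model of `T`.
            proj₁ (bisimilar-concept S E (sig small-E) b) (proj₁ (bis-concept S (suc n) E small-E bis-apex) h))

        below : ∀ {r b} → r ∈ rnames S → Arrow r apex b → SatExSim S T graft b
        below _ (enter {e} _) = J.model e , J.isModel e , J.centre e , at-bisimilar S e (J.centre e)

    -- Depths up to `m` come from `shallow-sat`; the inductive step takes over from there.
    preserved : ¬ StarCond S T m → ∀ n → Preserved n
    preserved ¬star zero small-E = shallow-sat (small-≤ S z≤n small-E)
    preserved ¬star (suc n) {E} small-E with m ≤? n
    ... | yes m≤n = preserved-suc ¬star n m≤n (preserved ¬star n) small-E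
    ... | no  m≰n = shallow-sat (small-≤ S (≰⇒> m≰n) small-E)

    ¬star⇒interpolant : S ⊆Sig sigT T → ¬ StarCond S T m → IsUniformInterpolant (TSigm T Cs) S T
    ¬star⇒interpolant S⊆T ¬star =
      (λ _ ((i , j) , _) → proj₁ (proj₁ cmf i) , proj₁ (proj₁ cmf j)) ,
      S⊆T ,
      λ (C , D) (sC , sD) →
        (λ ent I mod d c → dne λ ¬d →
          -- A counterexample to the inclusion is an instance of this Σ-concept, which then is
          -- satisfiable with `T` as well.
          let E = C ⊓ neg D
              s = small-⊓ S (small-≤ S (m≤m⊔n (rd C) (rd D)) (small sC ≤-refl))
                            (small-neg S (small-≤ S (m≤n⊔m (rd C) (rd D)) (small sD ≤-refl)))
              (J , modJ , e , x , ¬y) =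
                preserved ¬star (rd E) {E} s (I , (λ i → mod _ (∈-shallow⁻ i)) , d , c , ¬d)
          in ¬y (ent J modJ e x)) ,
        λ ent I mod → ent I λ _ (_ , ent′) → ent′ I mod

theorem4 : (lem : ∀ {ℓ} → ExcludedMiddle ℓ)
    → (T : TBox) (S : Signature) → S ⊆Sig sigT T → (m : ℕ)
    → (Cs : List Concept) → IsCmf S m Cs
    → ((¬ IsUniformInterpolant (TSigm T Cs) S T) → StarCond S T m)
    × (StarCond S T m → ¬ IsUniformInterpolant (TSigm T Cs) S T)
theorem4 lem T S S⊆T m Cs cmf =
  (λ ¬interpolant → dne λ ¬star → ¬interpolant (¬star⇒interpolant cmf S⊆T ¬star)) ,
  star⇒¬interpolant cmf
  where open Classical lem
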